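{- Let $G$ be a graph containing a cycle, with girth $g(G)$. Then $L_2(G)\geq \left\lfloor\frac{2g(G)}{3}\right\rfloor$, and for every integer $k$ with $\Delta(G)\geq k\geq 3$ one has $L_k(G)\geq g(G)+k-3$. Moreover, the lower bounds are tight: there is a graph $G$ containing a cycle with $L_2(G)=\left\lfloor\frac{2g(G)}{3}\right\rfloor$, and for every $k\geq 3$ there is a graph $G$ containing a cycle with $\Delta(G)\ge k$ and $L_k(G)=g(G)+k-3$.
   Context: All graphs are finite, undirected, simple and nontrivial (at least two vertices). The girth $g(G)$ is the length of a shortest cycle in $G$, $\Delta(G)$ is the maximum degree, and $N[v]=\{v\}\cup N(v)$ is the closed neighbourhood of $v$. For an integer $k\ge 1$, a set $B\subseteq V(G)$ is a $k$-limited packing if $|N[v]\cap B|\le k$ for every vertex $v$ of $G$; $L_k(G)$ is the maximum cardinality of a $k$-limited packing in $G$. -}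

module Defs where

open import Data.Empty using (⊥)
open import Data.Fin.Base using (Fin; fromℕ<)
open import Data.Fin.Properties using (all?; any?) renaming (_≟_ to _≟ᶠ_)
open import Data.Fin.Subset using (Subset; ⁅_⁆; _∪_; _∩_; ∣_∣) renaming (⊥ to ∅)
open import Data.Fin.Subset.Properties using (anySubset?; ∣p∣≤n; ∣⊥∣≡0; ∩-zeroʳ)
open import Data.Nat.Base
open import Data.Nat.Properties
open import Data.Product.Base using (∃; _×_; _,_; proj₁)
open import Data.Vec.Base using (Vec; []; _∷_; _∷ʳ_; tabulate)
open import Data.Vec.Relation.Unary.AllPairs using (allPairs?)
open import Data.Vec.Relation.Unary.Linked using (Linked; linked?)
open import Data.Vec.Relation.Unary.Unique.Propositional using (Unique)
open import Level using (0ℓ)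
open import Relation.Binary.Core using (Rel)
import Relation.Binary.Definitions as B
open import Relation.Binary.PropositionalEquality
open import Relation.Nullary using (Dec; yes; no; does)
open import Relation.Nullary.Decidable using (_×-dec_; ¬?; map′)
open import Relation.Nullary.Negation using (contradiction)
open import Relation.Unary using (Pred; Decidable)

IsLeast IsGreatest : Pred ℕ 0ℓ → Pred ℕ 0ℓ
IsLeast    P m = P m × (∀ {j} → P j → m ≤ j)
IsGreatest P m = P m × (∀ {j} → P j → j ≤ m)

module _ {P : Pred ℕ 0ℓ} (P? : Decidable P) where

  private
    -- The fuel f bounds the distance from the starting point i to a witness.
    leastFrom : ∀ f i → (∀ {j} → P j → i ≤ j) → P (f + i) → ∃ (IsLeast P)
    leastFrom zero    i lb p = i , p , lb
    leastFrom (suc f) i lb p with P? i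
    ... | yes pᵢ = i , pᵢ , lb
    ... | no ¬pᵢ = leastFrom f (suc i)
      (λ pⱼ → ≤∧≢⇒< (lb pⱼ) λ { refl → ¬pᵢ pⱼ })
      (subst P (sym (+-suc f i)) p)

    greatestBelow : ∀ b → (∀ {j} → P j → j ≤ b) → ∃ P → ∃ (IsGreatest P)
    greatestBelow b ub e with P? b
    ... | yes p = b , p , ub
    greatestBelow zero    ub (j , pⱼ) | no ¬p =
      contradiction (subst P (n≤0⇒n≡0 (ub pⱼ)) pⱼ) ¬p
    greatestBelow (suc b) ub e | no ¬p =
      greatestBelow b (λ pⱼ → s≤s⁻¹ (≤∧≢⇒< (ub pⱼ) λ { refl → ¬p pⱼ })) e

  -- Abstract because only the specification in the type is meant to be used.
  abstract
    least : ∃ P → ∃ (IsLeast P)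
    least (j , pⱼ) =
      leastFrom j 0 (λ _ → z≤n) (subst P (sym (+-identityʳ j)) pⱼ)

    greatest : ∀ b → (∀ {j} → P j → j ≤ b) → ∃ P → ∃ (IsGreatest P)
    greatest = greatestBelow

anyVec? : ∀ {n ℓ} {P : Pred (Vec (Fin n) ℓ) 0ℓ} → Decidable P → Dec (∃ P)
anyVec? {ℓ = zero}  P? = map′ ([] ,_) (λ { ([] , p) → p }) (P? [])
anyVec? {ℓ = suc ℓ} P? = map′
  (λ { (x , xs , p) → x ∷ xs , p }) (λ { (x ∷ xs , p) → x , xs , p })
  (any? λ x → anyVec? λ xs → P? (x ∷ xs))

record Graph : Set₁ where
  infix 4 _~_

  field
    order      : ℕ
    nontrivial : 2 ≤ order

  Vertex : Set
  Vertex = Fin order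

  field
    _~_      : Rel Vertex 0ℓ
    ~-sym    : B.Symmetric _~_
    ~-irrefl : B.Irreflexive _≡_ _~_
    _~?_     : B.Decidable _~_

  N : Vertex → Subset order
  N v = tabulate λ u → does (v ~? u)

  N[_] : Vertex → Subset order
  N[ v ] = ⁅ v ⁆ ∪ N v

  degree : Vertex → ℕ
  degree v = ∣ N v ∣

  -- Repeating the first vertex at the end makes Linked cover the closing edge.
  IsCycle : ∀ {ℓ} → Vec Vertex ℓ → Set
  IsCycle         []          = ⊥
  IsCycle {ℓ = ℓ} vs@(v ∷ _) = 3 ≤ ℓ × Unique vs × Linked _~_ (vs ∷ʳ v)

  HasCycleOfLength : ℕ → Set
  HasCycleOfLength ℓ = ∃ λ (vs : Vec Vertex ℓ) → IsCycle vs

  HasCycle : Set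
  HasCycle = ∃ HasCycleOfLength

  IsLimitedPacking : ℕ → Subset order → Set
  IsLimitedPacking k B = ∀ v → ∣ N[ v ] ∩ B ∣ ≤ k

  HasLimitedPackingOfSize : ℕ → ℕ → Set
  HasLimitedPackingOfSize k m = ∃ λ B → IsLimitedPacking k B × ∣ B ∣ ≡ m

  isCycle? : ∀ {ℓ} → Decidable (IsCycle {ℓ})
  isCycle? []         = no λ ()
  isCycle? vs@(v ∷ _) =
    3 ≤? _ ×-dec allPairs? (λ x y → ¬? (x ≟ᶠ y)) vs ×-dec linked? _~?_ (vs ∷ʳ v)

  hasCycleOfLength? : Decidable HasCycleOfLength
  hasCycleOfLength? ℓ = anyVec? isCycle?

  hasLimitedPackingOfSize? : ∀ k → Decidable (HasLimitedPackingOfSize k)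
  hasLimitedPackingOfSize? k m = anySubset? λ B →
    all? (λ v → ∣ N[ v ] ∩ B ∣ ≤? k) ×-dec (∣ B ∣ ≟ m)

open Graph public using
  (HasCycle; HasCycleOfLength; HasLimitedPackingOfSize; IsLimitedPacking)

∃girth : (G : Graph) → HasCycle G → ∃ (IsLeast (HasCycleOfLength G))
∃girth G = least (Graph.hasCycleOfLength? G)

∃Δ : (G : Graph) → ∃ (IsGreatest λ d → ∃ λ v → Graph.degree G v ≡ d)
∃Δ G = greatest (λ d → any? λ v → degree v ≟ d) order
  (λ { (v , refl) → ∣p∣≤n (N v) }) (degree v₀ , v₀ , refl)
  where
  open Graph G
  v₀ : Vertex
  v₀ = fromℕ< nontrivial

∃L : ∀ k (G : Graph) → ∃ (IsGreatest (HasLimitedPackingOfSize G k))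
∃L k G = greatest (hasLimitedPackingOfSize? k) order
  (λ { (B , _ , refl) → ∣p∣≤n B })
  (0 , ∅ , (λ v → ≤-trans (≤-reflexive (∅-empty v)) z≤n) , ∣⊥∣≡0 order)
  where
  open Graph G
  ∅-empty : ∀ v → ∣ N[ v ] ∩ ∅ ∣ ≡ 0
  ∅-empty v = trans (cong ∣_∣ (∩-zeroʳ N[ v ])) (∣⊥∣≡0 order)

-- The value does not depend on the proof that G has a cycle, which only
-- ensures that there is a shortest one.
girth : (G : Graph) → HasCycle G → ℕ
girth G c = proj₁ (∃girth G c)

Δ : Graph → ℕ
Δ G = proj₁ (∃Δ G)

L : ℕ → Graph → ℕ
L k G = proj₁ (∃L k G)

{-# OPTIONS --safe #-}

-- Let C be a shortest cycle c₀ , … , c_{g-1}, with g the girth.  A vertex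
-- outside C adjacent to cᵢ and cⱼ, i < j, closes a cycle of length
-- j - i + 2 ≥ g, and C has no chords; so every closed neighbourhood meets C in
-- at most three vertices, which are cyclically consecutive when its centre is
-- on C.  Hence C with k - 3 arbitrary further vertices is a k-limited packing
-- (there are enough of them around a vertex of maximum degree), and C without
-- every third vertex is a 2-limited packing.  Both bounds are attained by the
-- complete graph on k + 1 vertices.
module Submission where

open import Defs
open import Data.Empty using (⊥)
open import Data.Fin.Base using (Fin; zero; suc)
open import Data.Fin.Properties using (suc-injective) renaming (_≟_ to _≟ᶠ_)
open import Data.Fin.Subset using (Subset; inside; outside; ⁅_⁆; _∪_; _∩_; ∣_∣; _⊆_)
  renaming (_∈_ to _∈ˢ_; ⊥ to ∅)
open import Data.Fin.Subset.Properties using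
  ( x∈⁅x⁆; x∈⁅y⁆⇒x≡y; ∣⁅x⁆∣≡1; ∣⊥∣≡0; ∉⊥; p⊆q⇒∣p∣≤∣q∣; x∈p∪q⁺; x∈p∪q⁻; x∈p∩q⁺
  ; x∈p∩q⁻; q⊆p∪q; x∈p⇒∣p-x∣<∣p∣; x∈p∧x≢y⇒x∈p-y )
  renaming (_∈?_ to _∈ˢ?_)
open import Data.List.Base using (List; []; _∷_; _++_; length; map; filter; take; upTo; allFin)
  renaming (tabulate to tabulateᴸ)
open import Data.List.Membership.Propositional using (_∈_; _∉_)
open import Data.List.Membership.DecPropositional using (_∈?_)
open import Data.List.Membership.Propositional.Properties using
  (∈-map⁻; ∈-++⁺ˡ; ∈-++⁺ʳ; ∈-++⁻; ∈-upTo⁺; ∈-upTo⁻; ∈-filter⁺; ∈-map⁺; ∈-allFin)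
open import Data.List.Properties using
  (length-map; length-++; length-take; length-upTo; length-tabulate)
open import Data.List.Relation.Unary.All as All using (All; []; _∷_)
import Data.List.Relation.Unary.All.Properties as All
open import Data.List.Relation.Unary.AllPairs using (AllPairs; []; _∷_)
import Data.List.Relation.Unary.AllPairs.Properties as AllPairs
open import Data.List.Relation.Unary.Any using (here; there)
open import Data.List.Relation.Unary.Unique.Propositional using (Unique)
import Data.List.Relation.Unary.Unique.Propositional.Properties as Unique
open import Data.Nat using
  (ℕ; zero; suc; _+_; _*_; _∸_; _/_; ⌊_/2⌋; ⌈_/2⌉; _≤_; _<_; _≥_; z≤n; s≤s; s≤s⁻¹; z<s)
open import Data.Nat.DivMod using (m/n*n≤m)
open import Data.Nat.Properties hiding (suc-injective; _≟_; ≟-diag)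
open import Data.Nat.Solver using (module +-*-Solver)
open import Data.Product using (_×_; Σ-syntax; ∃; _,_; proj₁; proj₂)
open import Data.Sum using (_⊎_; inj₁; inj₂)
open import Data.Vec.Base using (Vec; []; _∷_; _∷ʳ_)
open import Data.Vec.Properties using (lookup∘tabulate; lookup⇒[]=; []=⇒lookup)
open import Data.Vec.Relation.Unary.All as Allⱽ using ([]; _∷_) renaming (All to Allⱽ)
open import Data.Vec.Relation.Unary.AllPairs using ([]; _∷_)
open import Data.Vec.Relation.Unary.Linked using (Linked; [-]; _∷_)
open import Data.Vec.Relation.Unary.Unique.Propositional using () renaming (Unique to Uniqueⱽ)
open import Function using (_∘_; id)
open import Relation.Binary.Core using (Rel)
open import Relation.Binary.Definitions using (tri<; tri≈; tri>)
open import Relation.Binary.PropositionalEquality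
open import Relation.Nullary using (yes; no; contradiction)
open import Relation.Nullary.Decidable using (dec-true; _×-dec_; ¬?)
open import Relation.Unary using (Decidable)
open import Level using (0ℓ)

-- Sizes of finite subsets via lists

∣p∪q∣≤∣p∣+∣q∣ : ∀ {n} (p q : Subset n) → ∣ p ∪ q ∣ ≤ ∣ p ∣ + ∣ q ∣
∣p∪q∣≤∣p∣+∣q∣ []            []            = z≤n
∣p∪q∣≤∣p∣+∣q∣ (outside ∷ p) (outside ∷ q) = ∣p∪q∣≤∣p∣+∣q∣ p q
∣p∪q∣≤∣p∣+∣q∣ (outside ∷ p) (inside ∷ q)  =
  ≤-trans (s≤s (∣p∪q∣≤∣p∣+∣q∣ p q)) (≤-reflexive (sym (+-suc ∣ p ∣ ∣ q ∣)))
∣p∪q∣≤∣p∣+∣q∣ (inside ∷ p)  (outside ∷ q) = s≤s (∣p∪q∣≤∣p∣+∣q∣ p q)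
∣p∪q∣≤∣p∣+∣q∣ (inside ∷ p)  (inside ∷ q)  =
  s≤s (≤-trans (∣p∪q∣≤∣p∣+∣q∣ p q) (+-monoʳ-≤ ∣ p ∣ (n≤1+n ∣ q ∣)))

fromList : ∀ {n} → List (Fin n) → Subset n
fromList []       = ∅
fromList (x ∷ xs) = ⁅ x ⁆ ∪ fromList xs

∈-fromList⁺ : ∀ {n} {x : Fin n} {xs} → x ∈ xs → x ∈ˢ fromList xs
∈-fromList⁺ {x = x} (here refl) = x∈p∪q⁺ (inj₁ (x∈⁅x⁆ x))
∈-fromList⁺ (there x∈xs)        = x∈p∪q⁺ (inj₂ (∈-fromList⁺ x∈xs))

∈-fromList⁻ : ∀ {n} {x : Fin n} xs → x ∈ˢ fromList xs → x ∈ xs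
∈-fromList⁻ []       x∈ = contradiction x∈ ∉⊥
∈-fromList⁻ (y ∷ xs) x∈ with x∈p∪q⁻ ⁅ y ⁆ (fromList xs) x∈
... | inj₁ x∈⁅y⁆ = here (x∈⁅y⁆⇒x≡y y x∈⁅y⁆)
... | inj₂ x∈xs  = there (∈-fromList⁻ xs x∈xs)

∣fromList∣≤length : ∀ {n} (xs : List (Fin n)) → ∣ fromList xs ∣ ≤ length xs
∣fromList∣≤length {n} []   = ≤-reflexive (∣⊥∣≡0 n)
∣fromList∣≤length (x ∷ xs) = ≤-trans (∣p∪q∣≤∣p∣+∣q∣ ⁅ x ⁆ (fromList xs))
  (+-mono-≤ (≤-reflexive (∣⁅x⁆∣≡1 x)) (∣fromList∣≤length xs))

∣p∣≤length : ∀ {n} {p : Subset n} xs → (∀ {x} → x ∈ˢ p → x ∈ xs) → ∣ p ∣ ≤ length xs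
∣p∣≤length xs p⊆xs =
  ≤-trans (p⊆q⇒∣p∣≤∣q∣ (∈-fromList⁺ ∘ p⊆xs)) (∣fromList∣≤length xs)

-- Deleting the head from `p` lowers the size of `p` and keeps the later entries inside, as they
-- differ from the head.
length≤∣p∣ : ∀ {n} {p : Subset n} {xs} → Unique xs → All (_∈ˢ p) xs → length xs ≤ ∣ p ∣
length≤∣p∣ []         []           = z≤n
length≤∣p∣ (x∉ ∷ uxs) (x∈p ∷ xs⊆p) = ≤-trans
  (s≤s (length≤∣p∣ uxs (All.zipWith (λ (x≢y , y∈p) → x∈p∧x≢y⇒x∈p-y y∈p (x≢y ∘ sym)) (x∉ , xs⊆p))))
  (x∈p⇒∣p-x∣<∣p∣ x∈p)

-- Reduces counting vertices to counting indices: `f` will run along the cycle, and `ys` will hold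
-- the vertices off it.
∣p∣≤filter+length : ∀ {n} {p : Subset n} (f : ℕ → Fin n) is ys →
  (∀ {x} → x ∈ˢ p → x ∈ map f is ⊎ x ∈ ys) →
  ∣ p ∣ ≤ length (filter (λ i → f i ∈ˢ? p) is) + length ys
∣p∣≤filter+length {p = p} f is ys cover = begin
  ∣ p ∣                         ≤⟨ ∣p∣≤length (map f hits ++ ys) enum ⟩
  length (map f hits ++ ys)     ≡⟨ length-++ (map f hits) ⟩
  length (map f hits) + length ys ≡⟨ cong (_+ length ys) (length-map f hits) ⟩
  length hits + length ys       ∎
  where
  open ≤-Reasoning
  hits : List ℕ
  hits = filter (λ i → f i ∈ˢ? p) is
  enum : ∀ {x} → x ∈ˢ p → x ∈ map f hits ++ ys
  enum x∈p with cover x∈p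
  ... | inj₂ x∈ys = ∈-++⁺ʳ (map f hits) x∈ys
  ... | inj₁ x∈is with i , i∈is , refl ← ∈-map⁻ f x∈is =
    ∈-++⁺ˡ (∈-map⁺ f (∈-filter⁺ (λ i → f i ∈ˢ? p) i∈is x∈p))

-- Increasing lists of indices

module _ {P : ℕ → Set} where

  length≤2 : (∀ {x y z} → x < y → y < z → P x → P y → P z → ⊥) →
    ∀ {xs} → AllPairs _<_ xs → All P xs → length xs ≤ 2
  length≤2 ¬P³ [] _                 = z≤n
  length≤2 ¬P³ (_ ∷ []) _           = s≤s z≤n
  length≤2 ¬P³ (_ ∷ (_ ∷ [])) _     = s≤s (s≤s z≤n)
  length≤2 ¬P³ ((x<y ∷ _) ∷ ((y<z ∷ _) ∷ _)) (px ∷ py ∷ pz ∷ _) =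
    contradiction pz (¬P³ x<y y<z px py)

  length≤3 : (∀ {x y z t} → x < y → y < z → z < t → P x → P y → P z → P t → ⊥) →
    ∀ {xs} → AllPairs _<_ xs → All P xs → length xs ≤ 3
  length≤3 ¬P⁴ [] _                     = z≤n
  length≤3 ¬P⁴ (_ ∷ []) _               = s≤s z≤n
  length≤3 ¬P⁴ (_ ∷ (_ ∷ [])) _         = s≤s (s≤s z≤n)
  length≤3 ¬P⁴ (_ ∷ (_ ∷ (_ ∷ []))) _   = s≤s (s≤s (s≤s z≤n))
  length≤3 ¬P⁴ ((x<y ∷ _) ∷ ((y<z ∷ _) ∷ ((z<t ∷ _) ∷ _))) (px ∷ py ∷ pz ∷ pt ∷ _) =
    contradiction pt (¬P⁴ x<y y<z z<t px py pz)

filter-AllPairs-< : ∀ {P : ℕ → Set} (P? : Decidable P) n → AllPairs _<_ (filter P? (upTo n))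
filter-AllPairs-< P? n = AllPairs.filter⁺ P? (AllPairs.applyUpTo⁺₁ id n (λ i<j _ → i<j))

filter-All : ∀ {P : ℕ → Set} (P? : Decidable P) n → All (λ i → i < n × P i) (filter P? (upTo n))
filter-All P? n = All.zip (All.filter⁺ P? (All.all-upTo n) , All.all-filter P? (upTo n))

-- Positions not divisible by 3

-- Enumerates the positive integers not divisible by 3.
φ : ℕ → ℕ
φ j = suc (j + ⌊ j /2⌋)

φ-mono-≤ : ∀ {i j} → i ≤ j → φ i ≤ φ j
φ-mono-≤ i≤j = s≤s (+-mono-≤ i≤j (⌊n/2⌋-mono i≤j))

φ-mono-< : ∀ {i j} → i < j → φ i < φ j
φ-mono-< {i} i<j = <-≤-trans (s≤s (s≤s (+-monoʳ-≤ i (⌊n/2⌋-mono (n≤1+n i))))) (φ-mono-≤ i<j)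

φ-injective : ∀ {i j} → φ i ≡ φ j → i ≡ j
φ-injective {i} {j} eq with <-cmp i j
... | tri< i<j _ _ = contradiction eq (<⇒≢ (φ-mono-< i<j))
... | tri≈ _ i≡j _ = i≡j
... | tri> _ _ j<i = contradiction (sym eq) (<⇒≢ (φ-mono-< j<i))

-- Used to see that among three selected positions the outer two are at least 3 apart.
φ[2+j]≡3+φ[j] : ∀ j → φ (2 + j) ≡ 3 + φ j
φ[2+j]≡3+φ[j] j = cong (3 +_) (+-suc j ⌊ j /2⌋)

-- As `⌊ j /2⌋` is at most half of `j`, twice `φ j` is at most 3j + 2, which is less than 3(j + 1)
-- and hence than 2g.
φ<g : ∀ g {j} → j < (2 * g) / 3 → φ j < g
φ<g g {j} j< = *-cancelˡ-< 2 (φ j) g (begin-strict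
  2 * φ j                           ≡⟨ solve 2 (λ j h →
    con 2 :* (con 1 :+ (j :+ h)) := con 2 :+ (con 2 :* j :+ (h :+ h))) refl j ⌊ j /2⌋ ⟩
  2 + (2 * j + (⌊ j /2⌋ + ⌊ j /2⌋)) ≤⟨
    +-monoʳ-≤ 2 (+-monoʳ-≤ (2 * j) (+-monoʳ-≤ ⌊ j /2⌋ (⌊n/2⌋≤⌈n/2⌉ j))) ⟩
  2 + (2 * j + (⌊ j /2⌋ + ⌈ j /2⌉)) ≡⟨ cong (λ h → 2 + (2 * j + h)) (⌊n/2⌋+⌈n/2⌉≡n j) ⟩
  2 + (2 * j + j)                   <⟨ ≤-refl ⟩
  3 + (2 * j + j)                   ≡⟨
    solve 1 (λ j → con 3 :+ (con 2 :* j :+ j) := (con 1 :+ j) :* con 3) refl j ⟩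
  suc j * 3                         ≤⟨ *-monoˡ-≤ 3 j< ⟩
  (2 * g) / 3 * 3                   ≤⟨ m/n*n≤m (2 * g) 3 ⟩
  2 * g                             ∎)
  where
  open ≤-Reasoning
  open +-*-Solver

-- Vectors indexed by natural numbers

-- Out of range, the default d is returned, so that the entries of the closed
-- walk vs ∷ʳ v are those of nth vs v.
nth : ∀ {A : Set} {n} → Vec A n → A → ℕ → A
nth []       d _       = d
nth (x ∷ xs) d zero    = x
nth (x ∷ xs) d (suc i) = nth xs d i

module _ {A : Set} where

  Allⱽ-nth : ∀ {P : A → Set} {n} {xs : Vec A n} {d} → Allⱽ P xs → ∀ {i} → i < n → P (nth xs d i)
  Allⱽ-nth (px ∷ _)  {zero}  _         = px
  Allⱽ-nth (_ ∷ pxs) {suc i} (s≤s i<n) = Allⱽ-nth pxs i<n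

  nth-injective : ∀ {n} {xs : Vec A n} {d} → Uniqueⱽ xs →
    ∀ {i j} → i < n → j < n → nth xs d i ≡ nth xs d j → i ≡ j
  nth-injective (_ ∷ _)  {zero}  {zero}  _ _ _          = refl
  nth-injective (p ∷ _)  {zero}  {suc j} _ (s≤s j<n) eq = contradiction eq (Allⱽ-nth p j<n)
  nth-injective (p ∷ _)  {suc i} {zero}  (s≤s i<n) _ eq = contradiction (sym eq) (Allⱽ-nth p i<n)
  nth-injective (_ ∷ us) {suc i} {suc j} (s≤s i<n) (s≤s j<n) eq =
    cong suc (nth-injective us i<n j<n eq)

  Linked-nth : ∀ {R : Rel A 0ℓ} {n} (xs : Vec A n) {d} → Linked R (xs ∷ʳ d) →
    ∀ {i} → i < n → R (nth xs d i) (nth xs d (suc i))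
  Linked-nth (x ∷ [])     (r ∷ _)  {zero}  _         = r
  Linked-nth (x ∷ [])     _        {suc i} (s≤s ())
  Linked-nth (x ∷ y ∷ xs) (r ∷ _)  {zero}  _         = r
  Linked-nth (x ∷ y ∷ xs) (_ ∷ rs) {suc i} (s≤s i<n) = Linked-nth (y ∷ xs) rs i<n

-- Neighbourhoods and extremal parameters

module _ (G : Graph) where
  open Graph G hiding (HasCycle; HasCycleOfLength; HasLimitedPackingOfSize; IsLimitedPacking)

  ∈-N⁺ : ∀ {v u} → v ~ u → u ∈ˢ N v
  ∈-N⁺ {v} {u} v~u = lookup⇒[]= u (N v) (trans (lookup∘tabulate _ u) (dec-true (v ~? u) v~u))

  ∈-N⁻ : ∀ {v u} → u ∈ˢ N v → v ~ u
  ∈-N⁻ {v} {u} u∈ with v ~? u | trans (sym (lookup∘tabulate _ u)) ([]=⇒lookup u∈)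
  ... | yes v~u | _ = v~u

  ∈-N[]⁻ : ∀ {v u} → u ∈ˢ N[ v ] → v ≡ u ⊎ v ~ u
  ∈-N[]⁻ {v} u∈ with x∈p∪q⁻ ⁅ v ⁆ (N v) u∈
  ... | inj₁ u∈⁅v⁆ = inj₁ (sym (x∈⁅y⁆⇒x≡y v u∈⁅v⁆))
  ... | inj₂ u∈N   = inj₂ (∈-N⁻ u∈N)

  girth-least : ∀ {c j} → HasCycleOfLength G j → girth G c ≤ j
  girth-least {c} = proj₂ (proj₂ (∃girth G c))

  3≤cycleLength : ∀ {ℓ} → HasCycleOfLength G ℓ → 3 ≤ ℓ
  3≤cycleLength (_ ∷ _ , 3≤ℓ , _) = 3≤ℓ

  hasShortestCycle : ∀ c → HasCycleOfLength G (girth G c)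
  hasShortestCycle c = proj₁ (proj₂ (∃girth G c))

  degree≤Δ : ∀ v → degree v ≤ Δ G
  degree≤Δ v = proj₂ (proj₂ (∃Δ G)) (v , refl)

  ∣packing∣≤L : ∀ {k B} → IsLimitedPacking G k B → ∣ B ∣ ≤ L k G
  ∣packing∣≤L {k} {B} B-packing = proj₂ (proj₂ (∃L k G)) (B , B-packing , refl)

  L-lub : ∀ {k m} → (∀ {B} → IsLimitedPacking G k B → ∣ B ∣ ≤ m) → L k G ≤ m
  L-lub {k} bound with (_ , B-packing , eq) ← proj₁ (proj₂ (∃L k G)) =
    ≤-trans (≤-reflexive (sym eq)) (bound B-packing)

  -- Segments and chords of a shortest cycle

  record ShortestCycle (g : ℕ) : Set where
    field
      c         : ℕ → Vertex
      injective : ∀ {i j} → i < g → j < g → c i ≡ c j → i ≡ j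
      step      : ∀ {i} → i < g → c i ~ c (suc i)
      shortest  : ∀ {j} → HasCycleOfLength G j → g ≤ j

  shortestCycle : ∀ {g} → HasCycleOfLength G g → (∀ {j} → HasCycleOfLength G j → g ≤ j) →
    ShortestCycle g
  shortestCycle (vs@(v ∷ _) , _ , unique , linked) g≤ = record
    { c         = nth vs v
    ; injective = nth-injective unique
    ; step      = Linked-nth vs linked
    ; shortest  = g≤
    }

  module _ {g} (C : ShortestCycle g) where
    open ShortestCycle C

    segment : ℕ → ∀ m → Vec Vertex m
    segment i zero    = []
    segment i (suc m) = c i ∷ segment (suc i) m

    segment-All : ∀ {P : Vertex → Set} i m → (∀ {j} → i ≤ j → j < i + m → P (c j)) →
      Allⱽ P (segment i m)
    segment-All i zero    _ = []
    segment-All i (suc m) p = p ≤-refl (m<m+n i z<s) ∷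
      segment-All (suc i) m λ {j} i<j j< → p (<⇒≤ i<j) (subst (j <_) (sym (+-suc i m)) j<)

    segment-Unique : ∀ i m → i + m ≤ g → Uniqueⱽ (segment i m)
    segment-Unique i zero    _     = []
    segment-Unique i (suc m) i+m≤g =
      segment-All (suc i) m
        (λ i<j j< eq → <⇒≢ i<j (injective (<-≤-trans (m<m+n i z<s) i+m≤g) (<-≤-trans j< i+m≤g′) eq))
      ∷ segment-Unique (suc i) m i+m≤g′
      where
      i+m≤g′ : suc i + m ≤ g
      i+m≤g′ = subst (_≤ g) (+-suc i m) i+m≤g

    -- The closing vertex `x` is left free: it is the start of the segment when a chord closes the
    -- cycle, and the outside vertex when a detour does.
    segment-Linked : ∀ i m {x} → i + m < g → c (i + m) ~ x →
      Linked _~_ (segment i (suc m) ∷ʳ x)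
    segment-Linked i zero    {x} i+m<g e = subst (λ k → c k ~ x) (+-identityʳ i) e ∷ [-]
    segment-Linked i (suc m) {x} i+m<g e =
      step (<-trans (m<m+n i z<s) i+m<g) ∷
      segment-Linked (suc i) m (subst (_< g) (+-suc i m) i+m<g)
        (subst (λ k → c k ~ x) (+-suc i m) e)

    -- A chord between `c i` and `c j` closes the segment between them to a cycle of length j - i +
    -- 1. This is at least g only if the segment is the whole cycle, and then the edge is the
    -- closing one.
    ~⇒consecutive : ∀ {i j} → i < j → j < g → c i ~ c j → suc i ≡ j ⊎ (i ≡ 0 × suc j ≡ g)
    ~⇒consecutive {i} i<j j<g e with m≤n⇒∃[o]m+o≡n i<j
    ... | zero  , refl = inj₁ (sym (+-identityʳ (suc i)))
    -- Here j = i + 2 + m, so the segment from `c i` to `c j` has 3 + m vertices, enough for a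
    -- cycle.
    ... | suc m , refl =
      inj₂ (i≡0 , ≤-antisym j<g (subst (λ k → g ≤ 2 + (k + suc m)) (sym i≡0) g≤))
      where
      open +-*-Solver
      length≡ : 2 + (i + suc m) ≡ i + (3 + m)
      length≡ = solve 2 (λ i m → con 2 :+ (i :+ (con 1 :+ m)) := i :+ (con 3 :+ m)) refl i m
      end≡ : i + (2 + m) ≡ suc i + suc m
      end≡ = +-suc i (suc m)
      chordCycle : HasCycleOfLength G (3 + m)
      chordCycle = segment i (3 + m) , s≤s (s≤s (s≤s z≤n)) ,
        segment-Unique i (3 + m) (subst (_≤ g) length≡ j<g) ,
        segment-Linked i (2 + m) (subst (_< g) (sym end≡) j<g)
          (subst (λ k → c k ~ c i) (sym end≡) (~-sym e))
      g≤ : g ≤ 3 + m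
      g≤ = shortest chordCycle
      i≡0 : i ≡ 0
      i≡0 = n≤0⇒n≡0 (+-cancelʳ-≤ (3 + m) i 0
        (≤-trans (≤-reflexive (sym length≡)) (≤-trans j<g g≤)))

    -- For j + 2 ≥ g + i read j - i ≥ g - 2.
    outside-far : ∀ {w i j} → (∀ {k} → k < g → w ≢ c k) → i < j → j < g → w ~ c i → w ~ c j →
      g + i ≤ 2 + j
    outside-far {w} {i} w∉ i<j j<g w~i w~j with m , refl ← m≤n⇒∃[o]m+o≡n i<j =
      ≤-trans (+-monoˡ-≤ i (shortest detour))
        (≤-reflexive (solve 2 (λ i m → con 3 :+ m :+ i := con 2 :+ (con 1 :+ i :+ m)) refl i m))
      where
      open +-*-Solver
      end : i + (2 + m) ≤ g
      end = subst (_≤ g) (solve 2 (λ i m → con 2 :+ i :+ m := i :+ (con 2 :+ m)) refl i m) j<g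
      detour : HasCycleOfLength G (3 + m)
      detour = w ∷ segment i (2 + m) , s≤s (s≤s (s≤s z≤n)) ,
        segment-All i (2 + m) (λ _ j< → w∉ (<-≤-trans j< end)) ∷ segment-Unique i (2 + m) end ,
        w~i ∷ segment-Linked i (1 + m) (subst (_< g) (sym (+-suc i m)) j<g)
          (subst (λ k → c k ~ w) (sym (+-suc i m)) (~-sym w~j))

    -- How closed neighbourhoods meet the cycle

    -- Cyclic distance at most one modulo g, with the wraparound between 0 and g - 1 as separate
    -- cases so that the rest is linear order.
    Near : ℕ → ℕ → Set
    Near a x = (x ≤ suc a × a ≤ suc x) ⊎ (x ≡ 0 × suc a ≡ g) ⊎ (a ≡ 0 × suc x ≡ g)

    N[c]⇒Near : ∀ {a x} → a < g → x < g → c x ∈ˢ N[ c a ] → Near a x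
    N[c]⇒Near {a} {x} a<g x<g x∈ with ∈-N[]⁻ x∈
    ... | inj₁ eq with refl ← injective a<g x<g eq = inj₁ (n≤1+n a , n≤1+n a)
    ... | inj₂ e with <-cmp a x
    ... | tri≈ _ refl _ = inj₁ (n≤1+n a , n≤1+n a)
    ... | tri< a<x _ _ with ~⇒consecutive a<x x<g e
    ...   | inj₁ refl = inj₁ (≤-refl , ≤-trans (n≤1+n a) (n≤1+n _))
    ...   | inj₂ eqs  = inj₂ (inj₂ eqs)
    N[c]⇒Near {a} {x} a<g x<g x∈ | inj₂ e | tri> _ _ x<a with ~⇒consecutive x<a a<g (~-sym e)
    ...   | inj₁ refl = inj₁ (≤-trans (n≤1+n x) (n≤1+n _) , ≤-refl)
    ...   | inj₂ eqs  = inj₂ (inj₁ eqs)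

    Near-interior : ∀ {a x} → 0 < x → suc x < g → Near a x → x ≤ suc a × a ≤ suc x
    Near-interior 0<x x<g (inj₁ near)                = near
    Near-interior 0<x x<g (inj₂ (inj₁ (refl , _)))   = contradiction 0<x λ ()
    Near-interior 0<x x<g (inj₂ (inj₂ (_ , refl)))   = contradiction x<g (<-irrefl refl)

    Near-last : ∀ {a x} → 0 < x → Near a x → x ≤ suc a ⊎ a ≡ 0
    Near-last 0<x (inj₁ (x≤ , _))          = inj₁ x≤
    Near-last 0<x (inj₂ (inj₁ (refl , _))) = contradiction 0<x λ ()
    Near-last 0<x (inj₂ (inj₂ (a≡0 , _)))  = inj₂ a≡0

    -- Without wraparound, `x` and `z` both lie within one of `a`, so z ≤ x + 2. As 0 is excluded,
    -- wraparound can only join a = 0 to the last position `z`, and then y ≤ 1 contradicts 0 < x <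
    -- y.
    ¬Near³-spread : ∀ {a x y z} → 0 < x → x < y → y < z → 3 + x ≤ z → z < g →
      Near a x → Near a y → Near a z → ⊥
    ¬Near³-spread {x = x} 0<x x<y y<z 3+x≤z z<g nx ny nz
      with Near-last (<-trans 0<x (<-trans x<y y<z)) nz
    ... | inj₁ z≤1+a = <-irrefl refl (≤-trans 3+x≤z (≤-trans z≤1+a (s≤s a≤1+x)))
      where
      a≤1+x : _ ≤ suc x
      a≤1+x = proj₂ (Near-interior 0<x (≤-<-trans (<⇒≤ (<⇒≤ 3+x≤z)) z<g) nx)
    ... | inj₂ refl = <-irrefl refl (<-≤-trans (s≤s 0<x) (≤-trans x<y
            (proj₁ (Near-interior (<-trans 0<x x<y) (≤-<-trans y<z z<g) ny))))

    -- The middle positions `y` and `z` are interior, hence within one of `a` in the linear order;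
    -- only `x` and `t` can be near `a` by wraparound.
    ¬Near⁴ : ∀ {a x y z t} → x < y → y < z → z < t → t < g →
      Near a x → Near a y → Near a z → Near a t → ⊥
    ¬Near⁴ {a} {x} {y} {z} {t} x<y y<z z<t t<g nx ny nz nt
      with 0<y ← ≤-<-trans z≤n x<y
      with 0<z ← <-trans 0<y y<z
      with Near-last (<-trans 0<z z<t) nt
    -- Here `a` is 0, so `z` is at most 1, although two positions precede it.
    ... | inj₂ refl = <-irrefl refl (<-≤-trans (s≤s 0<y) (≤-trans y<z
            (proj₁ (Near-interior 0<z (≤-<-trans z<t t<g) nz))))
    ... | inj₁ t≤ with a≤1+y ← proj₂ (Near-interior 0<y (≤-<-trans y<z (<-trans z<t t<g)) ny) | nx
    ...   | inj₁ (_ , a≤1+x) = <-irrefl refl (<-≤-trans z<t (≤-trans t≤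
              (≤-trans (s≤s (≤-trans a≤1+x x<y)) y<z)))
    -- Here a = g - 1, so a ≤ y + 1 leaves no room for both `z` and `t` between `y` and g.
    ...   | inj₂ (inj₁ (_ , refl)) = <-irrefl refl (<-≤-trans t<g
              (≤-trans (s≤s a≤1+y) (≤-trans (s≤s y<z) z<t)))
    ...   | inj₂ (inj₂ (_ , refl)) = 
              <-irrefl refl (<-≤-trans (<-trans (<-trans x<y y<z) z<t) (s≤s⁻¹ t<g))

    -- By `outside-far`, j - i ≥ g - 2 for two neighbours of `w`. With x ≥ 1 this forces y ≥ g - 1,
    -- so no position `z` can follow `y`.
    ¬outside³ : ∀ {w x y z} → (∀ {k} → k < g → w ≢ c k) → 0 < x → x < y → y < z → z < g →
      w ~ c x → w ~ c y → ⊥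
    ¬outside³ {w} {x} {y} w∉ 0<x x<y y<z z<g w~x w~y = <-irrefl refl (begin-strict
      g         ≤⟨ s≤s⁻¹ (begin
        1 + g     ≤⟨ +-monoˡ-≤ g 0<x ⟩
        x + g     ≡⟨ +-comm x g ⟩
        g + x     ≤⟨ outside-far w∉ x<y (<-trans y<z z<g) w~x w~y ⟩
        2 + y     ∎) ⟩
      1 + y     ≤⟨ y<z ⟩
      _         <⟨ z<g ⟩
      g         ∎)
      where open ≤-Reasoning

    onCycle? : ∀ w → (∃ λ a → a < g × w ≡ c a) ⊎ (∀ {k} → k < g → w ≢ c k)
    onCycle? w with _∈?_ _≟ᶠ_ w (map c (upTo g))
    ... | yes w∈C with a , a∈ , w≡ ← ∈-map⁻ c w∈C = inj₁ (a , ∈-upTo⁻ a∈ , w≡)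
    ... | no w∉C = inj₂ λ { k<g refl → w∉C (∈-map⁺ c (∈-upTo⁺ k<g)) }

    outside⇒~ : ∀ {w x} → (∀ {k} → k < g → w ≢ c k) → x < g → c x ∈ˢ N[ w ] → w ~ c x
    outside⇒~ w∉ x<g x∈ with ∈-N[]⁻ x∈
    ... | inj₁ w≡c = contradiction w≡c (w∉ x<g)
    ... | inj₂ w~c = w~c

    -- Stated for any part `p` of the neighbourhood, since it is applied both to the trace of a
    -- packing and to the full closed neighbourhood of a vertex of maximum degree.
    hits≤3 : ∀ {w p} → p ⊆ N[ w ] → length (filter (λ i → c i ∈ˢ? p) (upTo g)) ≤ 3
    hits≤3 {w} {p} p⊆N[w] = length≤3 ¬four (filter-AllPairs-< _ g) (filter-All _ g)
      where
      Hit : ℕ → Set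
      Hit i = i < g × c i ∈ˢ p
      ¬four : ∀ {x y z t} → x < y → y < z → z < t → Hit x → Hit y → Hit z → Hit t → ⊥
      ¬four x<y y<z z<t hx hy hz ht@(t<g , _) with onCycle? w
      ... | inj₁ (a , a<g , refl) =
        ¬Near⁴ x<y y<z z<t t<g (near hx) (near hy) (near hz) (near ht)
        where
        near : ∀ {i} → Hit i → Near a i
        near (i<g , i∈p) = N[c]⇒Near a<g i<g (p⊆N[w] i∈p)
      -- The first hit may be at position 0, so the argument runs on the last three, whose positions
      -- are positive.
      ... | inj₂ w∉ = ¬outside³ w∉ (≤-<-trans z≤n x<y) y<z z<t t<g (adj hy) (adj hz)
        where
        adj : ∀ {i} → Hit i → w ~ c i
        adj (i<g , i∈p) = outside⇒~ w∉ i<g (p⊆N[w] i∈p)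

    -- The selected positions are positive and skip every third one, so three hits are already
    -- contradictory, by spread if `w` is on the cycle and by `¬outside³` otherwise.
    φ-hits≤2 : ∀ {w p} → p ⊆ N[ w ] →
      length (filter (λ j → c (φ j) ∈ˢ? p) (upTo ((2 * g) / 3))) ≤ 2
    φ-hits≤2 {w} {p} p⊆N[w] = length≤2 ¬three (filter-AllPairs-< _ m) (filter-All _ m)
      where
      m : ℕ
      m = (2 * g) / 3
      Hit : ℕ → Set
      Hit j = j < m × c (φ j) ∈ˢ p
      ¬three : ∀ {x y z} → x < y → y < z → Hit x → Hit y → Hit z → ⊥
      ¬three {x} {z = z} x<y y<z hx hy hz@(z< , _) with onCycle? w
      ... | inj₁ (a , a<g , refl) =
        ¬Near³-spread z<s (φ-mono-< x<y) (φ-mono-< y<z)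
          (subst (_≤ φ z) (φ[2+j]≡3+φ[j] x) (φ-mono-≤ (≤-trans (s≤s x<y) y<z)))
          (φ<g g z<) (near hx) (near hy) (near hz)
        where
        near : ∀ {j} → Hit j → Near a (φ j)
        near (j< , j∈p) = N[c]⇒Near a<g (φ<g g j<) (p⊆N[w] j∈p)
      ... | inj₂ w∉ = ¬outside³ w∉ z<s (φ-mono-< x<y) (φ-mono-< y<z) (φ<g g z<) (adj hx) (adj hy)
        where
        adj : ∀ {j} → Hit j → w ~ c (φ j)
        adj (j< , j∈p) = outside⇒~ w∉ (φ<g g j<) (p⊆N[w] j∈p)

    -- The two lower bounds

    L₂-bound : (2 * g) / 3 ≤ L 2 G
    L₂-bound = ≤-trans size (∣packing∣≤L packing)
      where
      m : ℕ
      m = (2 * g) / 3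
      vs : List Vertex
      vs = map (c ∘ φ) (upTo m)
      packing : IsLimitedPacking G 2 (fromList vs)
      packing w = ≤-trans
        (∣p∣≤filter+length (c ∘ φ) (upTo m) []
          (inj₁ ∘ ∈-fromList⁻ vs ∘ proj₂ ∘ x∈p∩q⁻ N[ w ] (fromList vs)))
        (+-mono-≤ (φ-hits≤2 {w} (proj₁ ∘ x∈p∩q⁻ N[ w ] (fromList vs))) (z≤n {0}))
      unique : Unique vs
      unique = AllPairs.map⁺ (AllPairs.applyUpTo⁺₁ id m λ i<j j<m eq →
        <⇒≢ i<j (φ-injective (injective (φ<g g (<-trans i<j j<m)) (φ<g g j<m) eq)))
      size : m ≤ ∣ fromList vs ∣
      size = ≤-trans (≤-reflexive (sym (trans (length-map (c ∘ φ) (upTo m)) (length-upTo m))))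
        (length≤∣p∣ unique (All.tabulate ∈-fromList⁺))

    -- The packing is the whole cycle with k - 3 vertices off it: a closed neighbourhood contains at
    -- most 3 of the former and at most k - 3 of the latter.
    Lₖ-bound : ∀ {k} → k ≤ Δ G → 3 ≤ k → (g + k) ∸ 3 ≤ L k G
    Lₖ-bound {k} k≤Δ 3≤k = ≤-trans size (∣packing∣≤L packing)
      where
      cycleVertices : List Vertex
      cycleVertices = map c (upTo g)

      hub : Vertex
      hub = proj₁ (proj₁ (proj₂ (∃Δ G)))

      k≤∣N[hub]∣ : k ≤ ∣ N[ hub ] ∣
      k≤∣N[hub]∣ = ≤-trans k≤Δ (≤-trans (≤-reflexive (sym (proj₂ (proj₁ (proj₂ (∃Δ G))))))
        (p⊆q⇒∣p∣≤∣q∣ (q⊆p∪q ⁅ hub ⁆ (N hub))))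

      extra? : Decidable (λ u → u ∈ˢ N[ hub ] × u ∉ cycleVertices)
      extra? u = (u ∈ˢ? N[ hub ]) ×-dec ¬? (_∈?_ _≟ᶠ_ u cycleVertices)

      candidates extras vs : List Vertex
      candidates = filter extra? (allFin order)
      extras     = take (k ∸ 3) candidates
      vs         = cycleVertices ++ extras

      -- At least k vertices lie in the closed neighbourhood of `hub`, and at most three of them are
      -- on the cycle.
      enough : k ∸ 3 ≤ length candidates
      enough = m≤n+o⇒m∸n≤o k 3 (≤-trans k≤∣N[hub]∣ (≤-trans
        (∣p∣≤filter+length c (upTo g) candidates cover)
        (+-monoˡ-≤ (length candidates) (hits≤3 {hub} id))))
        where
        cover : ∀ {u} → u ∈ˢ N[ hub ] → u ∈ cycleVertices ⊎ u ∈ candidates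
        cover {u} u∈ with _∈?_ _≟ᶠ_ u cycleVertices
        ... | yes u∈C = inj₁ u∈C
        ... | no u∉C  = inj₂ (∈-filter⁺ extra? (∈-allFin u) (u∈ , u∉C))

      length-extras : length extras ≡ k ∸ 3
      length-extras = trans (length-take (k ∸ 3) candidates) (m≤n⇒m⊓n≡m enough)

      packing : IsLimitedPacking G k (fromList vs)
      packing w = begin
        ∣ N[ w ] ∩ fromList vs ∣ ≤⟨ ∣p∣≤filter+length c (upTo g) extras
          (∈-++⁻ cycleVertices ∘ ∈-fromList⁻ vs ∘ proj₂ ∘ x∈p∩q⁻ N[ w ] (fromList vs)) ⟩
        _ + length extras        ≤⟨ +-monoˡ-≤ (length extras)
          (hits≤3 {w} (proj₁ ∘ x∈p∩q⁻ N[ w ] (fromList vs))) ⟩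
        3 + length extras        ≡⟨ cong (3 +_) length-extras ⟩
        3 + (k ∸ 3)              ≡⟨ m+[n∸m]≡n 3≤k ⟩
        k                        ∎
        where open ≤-Reasoning

      unique : Unique vs
      unique = Unique.++⁺
        (AllPairs.map⁺ (AllPairs.applyUpTo⁺₁ id g λ i<j j<g eq →
          <⇒≢ i<j (injective (<-trans i<j j<g) j<g eq)))
        (Unique.take⁺ (k ∸ 3) (Unique.filter⁺ extra? (Unique.allFin⁺ order)))
        λ (u∈C , u∈extras) → proj₂ (All.lookup
          (All.take⁺ (k ∸ 3) (All.all-filter extra? (allFin order))) u∈extras) u∈C

      size : (g + k) ∸ 3 ≤ ∣ fromList vs ∣
      size = begin
        (g + k) ∸ 3                          ≡⟨ +-∸-assoc g 3≤k ⟩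
        g + (k ∸ 3)                          ≡⟨ cong₂ _+_
          (trans (length-map c (upTo g)) (length-upTo g)) length-extras ⟨
        length cycleVertices + length extras ≡⟨ length-++ cycleVertices ⟨
        length vs                            ≤⟨ length≤∣p∣ unique (All.tabulate ∈-fromList⁺) ⟩
        ∣ fromList vs ∣                      ∎
        where open ≤-Reasoning

-- Complete graphs as extremal examples

complete : ∀ {k} → 2 ≤ k → Graph
complete {k} 2≤k = record
  { order      = suc k
  ; nontrivial = ≤-trans 2≤k (n≤1+n k)
  ; _~_        = _≢_
  ; ~-sym      = λ x≢y → x≢y ∘ sym
  ; ~-irrefl   = λ x≡y x≢y → x≢y x≡y
  ; _~?_       = λ x y → ¬? (x ≟ᶠ y)
  }

complete-triangle : ∀ {k} (2≤k : 2 ≤ k) → HasCycleOfLength (complete 2≤k) 3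
complete-triangle (s≤s (s≤s _)) =
  zero ∷ suc zero ∷ suc (suc zero) ∷ [] , ≤-refl ,
  ((λ ()) ∷ (λ ()) ∷ []) ∷ ((λ ()) ∷ []) ∷ [] ∷ [] ,
  (λ ()) ∷ (λ ()) ∷ (λ ()) ∷ [-]

module _ {k} (2≤k : 2 ≤ k) where

  private
    K : Graph
    K = complete 2≤k
    module K = Graph K

  complete-cycle : HasCycle K
  complete-cycle = 3 , complete-triangle 2≤k

  complete-girth : girth K complete-cycle ≡ 3
  complete-girth = ≤-antisym (girth-least K {complete-cycle} (complete-triangle 2≤k))
    (3≤cycleLength K (hasShortestCycle K complete-cycle))

  complete-Δ : k ≤ Δ K
  complete-Δ = begin
    k                              ≡⟨ length-tabulate {n = k} suc ⟨
    length (tabulateᴸ {n = k} suc) ≤⟨ length≤∣p∣ {p = K.N zero}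
      (Unique.tabulate⁺ suc-injective) (All.tabulate⁺ λ i → ∈-N⁺ K {zero} {suc i} λ ()) ⟩
    K.degree zero                  ≤⟨ degree≤Δ K zero ⟩
    Δ K                            ∎
    where open ≤-Reasoning

  -- A single closed neighbourhood is the whole vertex set, so the packing condition at `zero`
  -- bounds all of `B`.
  complete-L≤ : L k K ≤ k
  complete-L≤ = L-lub K λ {B} B-packing → ≤-trans
    (p⊆q⇒∣p∣≤∣q∣ {p = B} {q = K.N[ zero ] ∩ B} λ {u} u∈B → x∈p∩q⁺ (∈N[zero] u , u∈B))
    (B-packing zero)
    where
    ∈N[zero] : ∀ u → u ∈ˢ K.N[ zero ]
    ∈N[zero] zero    = x∈p∪q⁺ {p = ⁅ zero ⁆} {q = K.N zero} (inj₁ (x∈⁅x⁆ {suc k} zero))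
    ∈N[zero] (suc u) =
      x∈p∪q⁺ {p = ⁅ zero ⁆} {q = K.N zero} (inj₂ (∈-N⁺ K {zero} {suc u} λ ()))

-- Lower bounds and their tightness

girthCycle : ∀ G c → ShortestCycle G (girth G c)
girthCycle G c = shortestCycle G (hasShortestCycle G c) (girth-least G {c})

theorem3p8 : ((G : Graph) (c : HasCycle G) →
    (L 2 G ≥ (2 * girth G c) / 3) ×
    (∀ k → Δ G ≥ k → k ≥ 3 → L k G ≥ (girth G c + k) ∸ 3))
    × (Σ[ G ∈ Graph ] Σ[ c ∈ HasCycle G ] L 2 G ≡ (2 * girth G c) / 3)
    × (∀ k → k ≥ 3 →
    Σ[ G ∈ Graph ] Σ[ c ∈ HasCycle G ]
    (Δ G ≥ k × L k G ≡ (girth G c + k) ∸ 3))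
theorem3p8 =
    (λ G c → L₂-bound G (girthCycle G c) , λ _ → Lₖ-bound G (girthCycle G c))
  -- The triangle: at girth 3 the bound evaluates to 2, the value given by `complete-L≤`.
  , (complete 2≤2 , complete-cycle 2≤2 , ≤-antisym
      (≤-trans (complete-L≤ 2≤2)
        (≤-reflexive (cong (λ g → (2 * g) / 3) (sym (complete-girth 2≤2)))))
      (L₂-bound _ (girthCycle _ (complete-cycle 2≤2))))
  -- At girth 3 the bound `(3 + k) ∸ 3` reduces to `k`, so `complete-L≤` meets it.
  , λ k 3≤k → let 2≤k = <⇒≤ 3≤k in
      complete 2≤k , complete-cycle 2≤k , complete-Δ 2≤k , ≤-antisym
        (≤-trans (complete-L≤ 2≤k)
          (≤-reflexive (cong (λ g → (g + k) ∸ 3) (sym (complete-girth 2≤k)))))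
        (Lₖ-bound _ (girthCycle _ (complete-cycle 2≤k)) (complete-Δ 2≤k) 3≤k)
  where
  2≤2 : 2 ≤ 2
  2≤2 = ≤-refl
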